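{- Let $p,r$ be natural numbers with $0<r<p$ and $\gcd(r,p)=1$. For integers $k,l$ let $Q_{r,p}(k,l)=\frac{p(k^2-l^2)}{2}+\frac{p(k+l)}{2}-lr$. Then for every natural number $n\ge 1$, $$\frac{1}{p}\sum_{\substack{d\ge 1,\ d\mid pn-r^2\\ d\equiv r\pmod p}}\left(d+\frac{pn-r^2}{d}\right)=\sum_{\substack{k_1,l_1,k_2,l_2\in\mathbb{Z}\\ k_1\ge|l_1|,\ k_2\ge|l_2|\\ n=Q_{r,p}(k_1,l_1)+Q_{r,p}(k_2,l_2)+r}}(-1)^{k_1+l_1+k_2+l_2}.$$
   Context: The left-hand sum is over the positive divisors $d$ of the (nonzero) integer $pn-r^2$ that are congruent to $r$ modulo $p$; equivalently, over factorizations $\delta d=pn-r^2$ with $d>0$, $d\equiv r\pmod p$, the summand being $d+\delta$. -}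

module Defs where

open import Data.Nat as ℕ using (ℕ)
open import Data.Integer as ℤ using (ℤ; +_; _+_; _-_; _*_; ∣_∣; 0ℤ; 1ℤ; -1ℤ)
open import Data.Integer.Divisibility using (_∣_)
open import Data.List using (List; foldr; map)
open import Data.Product using (_×_; _,_)
open import Relation.Binary.PropositionalEquality using (_≡_)

sumℤ : List ℤ → ℤ
sumℤ = foldr _+_ 0ℤ

negOnePow : ℤ → ℤ
negOnePow x with ∣ x ∣ ℕ.% 2
... | ℕ.zero = 1ℤ
... | ℕ.suc _ = -1ℤ

twoQ : ℕ → ℕ → ℤ → ℤ → ℤ
twoQ p r k l = + p * (k * k - l * l) + + p * (k + l) - + 2 * l * + r

IsDivisorPair : ℕ → ℕ → ℕ → ℤ × ℤ → Set
IsDivisorPair p r n (d , δ) =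
  (δ * d ≡ + (p ℕ.* n) - + (r ℕ.* r)) × (0ℤ ℤ.< d) × (+ p ∣ (d - + r))

-- Quadruples (k₁ , l₁ , k₂ , l₂) with k₁ ≥ |l₁|, k₂ ≥ |l₂| and
-- n = Q(k₁,l₁) + Q(k₂,l₂) + r   (stated after multiplying by 2).
IsSolution : ℕ → ℕ → ℕ → ℤ × ℤ × ℤ × ℤ → Set
IsSolution p r n (k₁ , l₁ , k₂ , l₂) =
  (+ ∣ l₁ ∣ ℤ.≤ k₁) × (+ ∣ l₂ ∣ ℤ.≤ k₂) ×
  (+ 2 * + n ≡ twoQ p r k₁ l₁ + twoQ p r k₂ l₂ + + 2 * + r)

divisorSum : List (ℤ × ℤ) → ℤ
divisorSum D = sumℤ (map (λ { (d , δ) → d + δ }) D)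

signSum : List (ℤ × ℤ × ℤ × ℤ) → ℤ
signSum S = sumℤ (map (λ { (k₁ , l₁ , k₂ , l₂) → negOnePow (k₁ + l₁ + k₂ + l₂) }) S)

{-# OPTIONS --safe #-}

-- Put Q(k,l) = (k + l)(k - l + 1), E = Q(k₁,l₁) + Q(k₂,l₂) and L = l₁ + l₂; a quadruple is a
-- solution iff p E + 2 r (1 - L) = 2 n. Writing d = r + p s and δ = p u - r, the divisor pairs are
-- the pairs s ≥ 0, u ≥ 1 with p s u + r (u - s) = n, and d + δ = p (s + u). With E = 2 s u and
-- L = 1 - (u - s) this is the same equation, so it suffices to compare, for fixed (E , L), the signed
-- count of quadruples with the sum of s + u. Both are invariant under (E , L) ↦ (E - 2 L , - L),
-- realised by l ↦ - l (resp. (s , u) ↦ (u - 1 , s + 1)), so let L ≤ 0.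
--
-- If E > 0, both are invariant under (E , L) ↦ (E + 2 L - 4 , L - 2), realised by l ↦ l - 1
-- (resp. (s , u) ↦ (s - 1 , u + 1)): the boundary terms for quadruples form a sum of (-1)^(x + y)
-- over the points with Q(x,y) = E, x + y ≥ 1, x ≥ y, which vanishes because y ↦ 1 - y preserves this
-- set and flips the sign. This lowers E until E = 0, where both sides are 1 - L, or E < 0, where both
-- are empty.
module Submission where

open import Defs
open import Data.Nat using (ℕ; _<_; _≤_)
open import Data.Nat.GCD using (gcd)
open import Data.Integer using (ℤ; +_; _*_)
open import Data.List using (List)
open import Data.List.Relation.Unary.Unique.Propositional using (Unique)
open import Data.List.Membership.Propositional using (_∈_)
open import Data.Product using (_×_)
open import Function.Bundles using (_⇔_)
open import Relation.Binary.PropositionalEquality using (_≡_)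

open import Algebra.Bundles using (CommutativeMonoid)
import Data.Integer as ℤ
open import Data.Integer using (-[1+_]; _+_; _-_; -_; ∣_∣; 0ℤ; 1ℤ; -1ℤ; +≤+)
import Data.Integer.Coprimality as ℤ-Coprimality
open import Data.Integer.Divisibility.Signed using (_∣_; divides; _∣?_; ∣ᵤ⇒∣; ∣⇒∣ᵤ)
import Data.Integer.Properties as ℤₚ
open import Data.Integer.Tactic.RingSolver using (solve)
open import Data.List using ([]; _∷_; _++_; map; filter; deduplicate; cartesianProduct; length; upTo)
open import Data.List.Membership.Propositional.Properties
  using ( ∈-map⁺; ∈-map⁻; ∈-++⁺ˡ; ∈-++⁺ʳ; ∈-++⁻; ∈-filter⁺; ∈-filter⁻; ∈-deduplicate⁺
        ; ∈-cartesianProduct⁺; ∈-upTo⁺; ∈-upTo⁻)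
open import Data.List.Membership.Propositional.Properties.WithK using (unique∧set⇒bag)
import Data.List.Properties as List
open import Data.List.Relation.Binary.BagAndSetEquality using (∼bag⇒↭)
open import Data.List.Relation.Binary.Permutation.Propositional using (_↭_; ↭⇒↭ₛ)
import Data.List.Relation.Binary.Permutation.Propositional.Properties as ↭
import Data.List.Relation.Binary.Permutation.Setoid.Properties as ↭ₛ
import Data.List.Relation.Unary.All as All
open import Data.List.Relation.Unary.AllPairs using ([]; _∷_)
open import Data.List.Relation.Unary.Any using (here; there)
open import Data.List.Relation.Unary.Unique.DecPropositional.Properties using (deduplicate-!)
import Data.List.Relation.Unary.Unique.Propositional.Properties as Unique
import Data.Nat as ℕ
open import Data.Nat using (zero; suc; z≤n; s≤s)
import Data.Nat.Coprimality as Coprimality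
import Data.Nat.Properties as ℕₚ
open import Data.Product using (_,_; proj₁; proj₂; ∃; ∃₂)
open import Data.Product.Properties using (≡-dec)
open import Data.Sum using (inj₁; inj₂; [_,_])
open import Function using (_∘_; id)
open import Function.Bundles using (mk⇔; module Equivalence)
open import Level using (0ℓ)
open import Relation.Binary.Definitions using (DecidableEquality)
open import Relation.Binary.PropositionalEquality
  using (_≢_; refl; sym; trans; cong; cong₂; subst; subst₂; setoid; module ≡-Reasoning)
open import Relation.Nullary using (¬_; Dec; yes; no; contradiction; ¬?)
open import Relation.Nullary.Decidable using (_×-dec_)
open import Relation.Unary using (Pred; Decidable; _∩_; _∪_; ∁; _⊆_)

-- Sums over finite predicates

sumℤ-↭ : ∀ {xs ys} → xs ↭ ys → sumℤ xs ≡ sumℤ ys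
sumℤ-↭ xs↭ys =
  ↭ₛ.foldr-commMonoid (setoid ℤ) (CommutativeMonoid.isCommutativeMonoid ℤₚ.+-0-commutativeMonoid) (↭⇒↭ₛ xs↭ys)

sumℤ-++ : ∀ xs ys → sumℤ (xs ++ ys) ≡ sumℤ xs + sumℤ ys
sumℤ-++ []       ys = sym (ℤₚ.+-identityˡ _)
sumℤ-++ (x ∷ xs) ys = trans (cong (_+_ x) (sumℤ-++ xs ys)) (sym (ℤₚ.+-assoc x _ _))

module _ {X : Set} where

  -- The value `v` is a parameter, so that a sum can be carried through bijections, splittings and
  -- reweightings without naming the list behind it.
  record SumOver (P : Pred X 0ℓ) (w : X → ℤ) (v : ℤ) : Set where
    constructor sumOver
    field
      support  : List X
      unique   : Unique support
      sound    : ∀ {x} → x ∈ support → P x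
      complete : ∀ {x} → P x → x ∈ support
      total    : sumℤ (map w support) ≡ v

  open SumOver

  -- Two duplicate-free lists with the same members are permutations of each other, and a sum is
  -- invariant under permutation.
  SumOver-unique : ∀ {P w a b} → SumOver P w a → SumOver P w b → a ≡ b
  SumOver-unique {w = w} A B = begin
    _                         ≡⟨ total A ⟨
    sumℤ (map w (support A))  ≡⟨ sumℤ-↭ (↭.map⁺ w (∼bag⇒↭ (unique∧set⇒bag (unique A) (unique B)
                                   (mk⇔ (complete B ∘ sound A) (complete A ∘ sound B))))) ⟩
    sumℤ (map w (support B))  ≡⟨ total B ⟩
    _                         ∎
    where open ≡-Reasoning

  SumOver-empty : ∀ {P w v} → (∀ x → ¬ P x) → SumOver P w v → v ≡ 0ℤ
  SumOver-empty ¬P (sumOver []      _ _     _ refl) = refl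
  SumOver-empty ¬P (sumOver (x ∷ _) _ sound _ _)    = contradiction (sound (here refl)) (¬P x)

  SumOver-scale : ∀ {P w v} c → SumOver P w v → SumOver P (λ x → c * w x) (c * v)
  SumOver-scale {w = w} c (sumOver L u s t refl) = sumOver L u s t (go L)
    where
    go : ∀ xs → sumℤ (map (λ x → c * w x) xs) ≡ c * sumℤ (map w xs)
    go []       = sym (ℤₚ.*-zeroʳ c)
    go (x ∷ xs) = trans (cong (_+_ (c * w x)) (go xs)) (sym (ℤₚ.*-distribˡ-+ c (w x) _))

  SumOver-∪ : ∀ {P Q w a b} → (∀ {x} → P x → ¬ Q x) →
              SumOver P w a → SumOver Q w b → SumOver (P ∪ Q) w (a + b)
  SumOver-∪ {w = w} disjoint A B = sumOver (support A ++ support B)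
    (Unique.++⁺ (unique A) (unique B) (λ (x∈A , x∈B) → disjoint (sound A x∈A) (sound B x∈B)))
    ([ inj₁ ∘ sound A , inj₂ ∘ sound B ] ∘ ∈-++⁻ (support A))
    [ ∈-++⁺ˡ ∘ complete A , ∈-++⁺ʳ (support A) ∘ complete B ]
    (trans (cong sumℤ (List.map-++ w (support A) (support B)))
      (trans (sumℤ-++ (map w (support A)) _) (cong₂ _+_ (total A) (total B))))

  SumOver-∩ : ∀ {P Q w v} → Decidable Q → SumOver P w v → ∃ (SumOver (P ∩ Q) w)
  SumOver-∩ Q? A = _ , sumOver (filter Q? (support A)) (Unique.filter⁺ Q? (unique A))
    (λ x∈ → let x∈A , Qx = ∈-filter⁻ Q? x∈ in sound A x∈A , Qx)
    (λ (Px , Qx) → ∈-filter⁺ Q? (complete A Px) Qx)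
    refl

  SumOver-finite : ∀ {P : Pred X 0ℓ} w → DecidableEquality X → Decidable P →
                   (cover : List X) → (∀ {x} → P x → x ∈ cover) → ∃ (SumOver P w)
  SumOver-finite w _≟_ P? cover P⊆cover = _ , sumOver (filter P? xs)
    (Unique.filter⁺ P? (deduplicate-! _≟_ cover))
    (λ x∈ → proj₂ (∈-filter⁻ P? {xs = xs} x∈))
    (λ Px → ∈-filter⁺ P? (∈-deduplicate⁺ _≟_ (P⊆cover Px)) Px)
    refl
    where xs = deduplicate _≟_ cover

open SumOver

module _ {X Y : Set} {P : Pred X 0ℓ} {Q : Pred Y 0ℓ} where

  -- The maps are inverse to each other only on `P` and `Q`, so they may take junk values elsewhere,
  -- as `quotient` does below.
  SumOver-bij : ∀ {w w′ v} (f : X → Y) (g : Y → X) →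
                (∀ {x} → P x → Q (f x)) → (∀ {y} → Q y → P (g y)) →
                (∀ {x} → P x → g (f x) ≡ x) → (∀ {y} → Q y → f (g y) ≡ y) →
                (∀ {x} → P x → w′ (f x) ≡ w x) →
                SumOver P w v → SumOver Q w′ v
  SumOver-bij {w} {w′} f g P⇒Q Q⇒P gf fg w≗ A = sumOver (map f xs)
    -- Since `f` may be injective on the support only, freedom from duplicates is read off after
    -- applying `g`, which restores the original list.
    (Unique.map⁻ (subst Unique (sym map-gf) (unique A)))
    (λ y∈ → let _ , x∈ , eq = ∈-map⁻ f y∈ in subst Q (sym eq) (P⇒Q (sound A x∈)))
    (λ Qy → subst (_∈ map f xs) (fg Qy) (∈-map⁺ f (complete A (Q⇒P Qy))))
    (trans (cong sumℤ (trans (sym (List.map-∘ xs)) (List.map-cong-local (All.tabulate (w≗ ∘ sound A)))))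
           (total A))
    where
    xs = support A
    map-gf : map g (map f xs) ≡ xs
    map-gf = trans (sym (List.map-∘ xs)) (List.map-id-local (All.tabulate (gf ∘ sound A)))

module _ {X : Set} {w : X → ℤ} where

  SumOver-resp : ∀ {P Q v} → P ⊆ Q → Q ⊆ P → SumOver P w v → SumOver Q w v
  SumOver-resp P⊆Q Q⊆P = SumOver-bij id id P⊆Q Q⊆P (λ _ → refl) (λ _ → refl) (λ _ → refl)

  SumOver-merge : ∀ {P Q a b} → Decidable Q →
                  SumOver (P ∩ Q) w a → SumOver (P ∩ ∁ Q) w b → SumOver P w (a + b)
  SumOver-merge {P} {Q} Q? A B = SumOver-resp [ proj₁ , proj₁ ] (λ {x} → classify (Q? x))
    (SumOver-∪ (λ (_ , Qx) (_ , ¬Qx) → ¬Qx Qx) A B)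
    where
    classify : ∀ {x} → Dec (Q x) → P x → ((P ∩ Q) ∪ (P ∩ ∁ Q)) x
    classify (yes q) p = inj₁ (p , q)
    classify (no ¬q) p = inj₂ (p , ¬q)

  SumOver-split : ∀ {P Q v} → Decidable Q → SumOver P w v →
                  ∃₂ λ a b → SumOver (P ∩ Q) w a × SumOver (P ∩ ∁ Q) w b × v ≡ a + b
  SumOver-split Q? A =
    let _ , A₁ = SumOver-∩ Q? A
        _ , A₂ = SumOver-∩ (¬? ∘ Q?) A
    in _ , _ , A₁ , A₂ , SumOver-unique A (SumOver-merge Q? A₁ A₂)

module _ {X Y K : Set} (_≟_ : DecidableEquality K) {w : X → ℤ} {w′ : Y → ℤ}
         (κ : X → K) (κ′ : Y → K) where

  -- The finitely many keys attained on either support are split off one at a time, and the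
  -- equalities of fibre sums are added.
  SumOver-fibrewise : ∀ {P Q a b} →
    (∀ k {a b} → SumOver (λ x → P x × κ x ≡ k) w a → SumOver (λ y → Q y × κ′ y ≡ k) w′ b → a ≡ b) →
    SumOver P w a → SumOver Q w′ b → a ≡ b
  SumOver-fibrewise {P} {Q} fibre A B =
    go (map κ (support A) ++ map κ′ (support B)) fibre
       (∈-++⁺ˡ ∘ ∈-map⁺ κ ∘ complete A) (∈-++⁺ʳ (map κ (support A)) ∘ ∈-map⁺ κ′ ∘ complete B) A B
    where
    go : ∀ (ks : List K) {P Q a b} →
         (∀ k {a b} → SumOver (λ x → P x × κ x ≡ k) w a → SumOver (λ y → Q y × κ′ y ≡ k) w′ b → a ≡ b) →
         (∀ {x} → P x → κ x ∈ ks) → (∀ {y} → Q y → κ′ y ∈ ks) →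
         SumOver P w a → SumOver Q w′ b → a ≡ b
    go [] _ P⊆ Q⊆ A B =
      trans (SumOver-empty (λ _ Px → case∈[] (P⊆ Px)) A) (sym (SumOver-empty (λ _ Qy → case∈[] (Q⊆ Qy)) B))
      where
      case∈[] : ∀ {k : K} → ¬ (k ∈ [])
      case∈[] ()
    go (k ∷ ks) {P} {Q} fib P⊆ Q⊆ A B =
      let _ , _ , A₁ , A₂ , a≡ = SumOver-split (λ x → κ x ≟ k) A
          _ , _ , B₁ , B₂ , b≡ = SumOver-split (λ y → κ′ y ≟ k) B
          a₂≡b₂ = go ks rest (λ (Px , ≢k) → tail ≢k (P⊆ Px)) (λ (Qy , ≢k) → tail ≢k (Q⊆ Qy)) A₂ B₂
      in trans a≡ (trans (cong₂ _+_ (fib k A₁ B₁) a₂≡b₂) (sym b≡))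
      where
      tail : ∀ {k′} → ¬ (k′ ≡ k) → k′ ∈ (k ∷ ks) → k′ ∈ ks
      tail ≢k (here eq)  = contradiction eq ≢k
      tail ≢k (there k∈) = k∈
      -- The key list may contain `k` again; its fibres are gone by then, so both sums are empty.
      rest : ∀ k′ {a b} → SumOver (λ x → (P x × ¬ κ x ≡ k) × κ x ≡ k′) w a →
             SumOver (λ y → (Q y × ¬ κ′ y ≡ k) × κ′ y ≡ k′) w′ b → a ≡ b
      rest k′ A B with k′ ≟ k
      ... | yes refl = trans (SumOver-empty (λ _ ((_ , ≢k) , eq) → ≢k eq) A)
                             (sym (SumOver-empty (λ _ ((_ , ≢k) , eq) → ≢k eq) B))
      ... | no k′≢k = fib k′
        (SumOver-resp (λ ((Px , _) , eq) → Px , eq) (λ { (Px , refl) → (Px , k′≢k) , refl }) A)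
        (SumOver-resp (λ ((Qy , _) , eq) → Qy , eq) (λ { (Qy , refl) → (Qy , k′≢k) , refl }) B)

SumOver-reweight : ∀ {X : Set} {P : Pred X 0ℓ} {w v} w′ → SumOver P w v → ∃ (SumOver P w′)
SumOver-reweight w′ (sumOver L u s c _) = _ , sumOver L u s c refl

SumOver-⇔ : ∀ {X : Set} {P : Pred X 0ℓ} {w} (L : List X) → Unique L → (∀ x → (x ∈ L) ⇔ P x) →
            SumOver P w (sumℤ (map w L))
SumOver-⇔ L unique L⇔P =
  sumOver L unique (λ {x} → Equivalence.to (L⇔P x)) (λ {x} → Equivalence.from (L⇔P x)) refl

-- Integer inequalities modulo linear equations

0≤-+ : ∀ {x y} → 0ℤ ℤ.≤ x → 0ℤ ℤ.≤ y → 0ℤ ℤ.≤ x + y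
0≤-+ = ℤₚ.+-mono-≤

0≤-* : ∀ {x y} → 0ℤ ℤ.≤ x → 0ℤ ℤ.≤ y → 0ℤ ℤ.≤ x * y
0≤-* {+ m} {+ n} _ _ = subst (0ℤ ℤ.≤_) (ℤₚ.pos-* m n) (+≤+ z≤n)

0≤1 : 0ℤ ℤ.≤ 1ℤ
0≤1 = +≤+ z≤n

0≤-half : ∀ {x} → 0ℤ ℤ.≤ x + x → 0ℤ ℤ.≤ x
0≤-half {+ _} _ = +≤+ z≤n

0≤-antisym : ∀ {x} → 0ℤ ℤ.≤ x → 0ℤ ℤ.≤ - x → x ≡ 0ℤ
0≤-antisym {+ zero} _ _ = refl

0≤-pred : ∀ {x} → 0ℤ ℤ.≤ x → x ≢ 0ℤ → 0ℤ ℤ.≤ x - 1ℤ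
0≤-pred {+ zero}  _ x≢0 = contradiction refl x≢0
0≤-pred {+ suc _} _ _   = +≤+ z≤n

positive⇒≢0 : ∀ {x} → 0ℤ ℤ.≤ x - 1ℤ → x ≢ 0ℤ
positive⇒≢0 () refl

0≰⇒ : ∀ {x} → ¬ 0ℤ ℤ.≤ x → 0ℤ ℤ.≤ -1ℤ - x
0≰⇒ {+ _}          0≰x = contradiction (+≤+ z≤n) 0≰x
0≰⇒ { -[1+ zero ]}  _  = +≤+ z≤n
0≰⇒ { -[1+ suc _ ]} _  = +≤+ z≤n

0≤-stable : ∀ {x} → ¬ 0ℤ ℤ.≤ -1ℤ - x → 0ℤ ℤ.≤ x
0≤-stable {x} ¬x<0 with 0ℤ ℤ.≤? x
... | yes 0≤x = 0≤x
... | no  0≰x = contradiction (0≰⇒ 0≰x) ¬x<0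

by : ∀ {x y} → 0ℤ ℤ.≤ x → y ≡ x → 0ℤ ℤ.≤ y
by 0≤x y≡x = subst (0ℤ ℤ.≤_) (sym y≡x) 0≤x

-- Contradictions are reached by exhibiting a combination of nonnegative terms whose value is -1.
0≰-1 : ∀ {x} → 0ℤ ℤ.≤ x → x ≢ -1ℤ
0≰-1 () refl

infixl 7 _·_
infixl 6 _⊕_

-- A multiple of a hypothesis, as one term of a linear combination. `_⊕_` adds such terms; `linear`
-- and `by-modulo` then leave only a polynomial identity for the ring solver.
_·_ : ∀ t {a b} → a ≡ b → t * (a - b) ≡ 0ℤ
t · a≡b = trans (cong (t *_) (ℤₚ.i≡j⇒i-j≡0 a≡b)) (ℤₚ.*-zeroʳ t)

_⊕_ : ∀ {x y} → x ≡ 0ℤ → y ≡ 0ℤ → x + y ≡ 0ℤ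
refl ⊕ refl = refl

linear : ∀ {x c d} → x ≡ 0ℤ → c - d ≡ x → c ≡ d
linear x≡0 eq = ℤₚ.i-j≡0⇒i≡j _ _ (trans eq x≡0)

by-modulo : ∀ {x y z} → 0ℤ ℤ.≤ x → z ≡ 0ℤ → y ≡ x + z → 0ℤ ℤ.≤ y
by-modulo {x} 0≤x z≡0 eq = by 0≤x (trans eq (trans (cong (_+_ x) z≡0) (ℤₚ.+-identityʳ x)))

x-1+1≡x : ∀ x → x - 1ℤ + 1ℤ ≡ x
x-1+1≡x x = solve (x ∷ [])

x+1-1≡x : ∀ x → x + 1ℤ - 1ℤ ≡ x
x+1-1≡x x = solve (x ∷ [])

-- Parity signs

negOnePow-suc : ∀ x → negOnePow (1ℤ + x) ≡ -1ℤ * negOnePow x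
negOnePow-suc (+ n) = go n
  where
  go : ∀ n → negOnePow (+ suc n) ≡ -1ℤ * negOnePow (+ n)
  go zero          = refl
  go (suc zero)    = refl
  go (suc (suc n)) = go n
negOnePow-suc -[1+ zero ]  = refl
-- Only the absolute value matters, so this is the natural case read backwards, -1 being its own
-- inverse.
negOnePow-suc -[1+ suc n ] = begin
  negOnePow -[1+ n ]                     ≡⟨⟩
  negOnePow (+ suc n)                    ≡⟨ involutive _ ⟨
  -1ℤ * (-1ℤ * negOnePow (+ suc n))      ≡⟨ cong (-1ℤ *_) (negOnePow-suc (+ suc n)) ⟨
  -1ℤ * negOnePow (+ suc (suc n))        ∎
  where
  open ≡-Reasoning
  involutive : ∀ x → -1ℤ * (-1ℤ * x) ≡ x
  involutive x = solve (x ∷ [])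

negOnePow-+2* : ∀ x y → negOnePow (x + (y + y)) ≡ negOnePow x
negOnePow-+2* = λ
  { x (+ n)    → natural x n
  -- For negative `y`, adding back twice its absolute value changes no sign by the natural case and
  -- restores `x`.
  ; x -[1+ n ] → trans (sym (natural (x + (-[1+ n ] + -[1+ n ])) (suc n)))
                       (cong negOnePow (cancel x (+ suc n)))
  }
  where
  open ≡-Reasoning
  rearrange : ∀ x m → x + ((1ℤ + m) + (1ℤ + m)) ≡ 1ℤ + (1ℤ + (x + (m + m)))
  rearrange x m = solve (x ∷ m ∷ [])
  involutive : ∀ x → -1ℤ * (-1ℤ * x) ≡ x
  involutive x = solve (x ∷ [])
  cancel : ∀ x m → x + (- m + - m) + (m + m) ≡ x
  cancel x m = solve (x ∷ m ∷ [])
  natural : ∀ x n → negOnePow (x + (+ n + + n)) ≡ negOnePow x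
  natural x zero    = cong negOnePow (ℤₚ.+-identityʳ x)
  natural x (suc n) = begin
    negOnePow (x + (+ suc n + + suc n))         ≡⟨ cong negOnePow (rearrange x (+ n)) ⟩
    negOnePow (1ℤ + (1ℤ + (x + (+ n + + n))))   ≡⟨ negOnePow-suc (1ℤ + (x + (+ n + + n))) ⟩
    -1ℤ * negOnePow (1ℤ + (x + (+ n + + n)))    ≡⟨ cong (-1ℤ *_) (negOnePow-suc (x + (+ n + + n))) ⟩
    -1ℤ * (-1ℤ * negOnePow (x + (+ n + + n)))   ≡⟨ involutive (negOnePow (x + (+ n + + n))) ⟩
    negOnePow (x + (+ n + + n))                 ≡⟨ natural x n ⟩
    negOnePow x                                 ∎

negOnePow-cong : ∀ a b → a ≡ b → negOnePow a ≡ negOnePow b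
negOnePow-cong _ _ refl = refl

negOnePow-odd : ∀ a b c → a ≡ 1ℤ + b + (c + c) → negOnePow a ≡ -1ℤ * negOnePow b
negOnePow-odd _ b c refl = trans (negOnePow-+2* (1ℤ + b) c) (negOnePow-suc b)

-- Quadruples at a fixed key, and signed sums over pairs

-- The condition k ≥ |l| is split into two linear inequalities. Each product is k k - l l + k + l,
-- the coefficient of `p` in `twoQ p r k l`; thus `E` collects the `p`-part of the equation and `L`
-- its `r`-part.
Quad : ℤ → ℤ → Pred (ℤ × ℤ × ℤ × ℤ) 0ℓ
Quad E L (k , l , k′ , l′) =
  0ℤ ℤ.≤ k + l × 0ℤ ℤ.≤ k - l × 0ℤ ℤ.≤ k′ + l′ × 0ℤ ℤ.≤ k′ - l′ ×
  (k + l) * (k - l + 1ℤ) + (k′ + l′) * (k′ - l′ + 1ℤ) ≡ E × l + l′ ≡ L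

quadSign : ℤ × ℤ × ℤ × ℤ → ℤ
quadSign (k , l , k′ , l′) = negOnePow (k + l + k′ + l′)

-- A quadruple with one point on an edge of the cone k ≥ |l| is determined by its other point, which
-- is recorded here. The bound x + y ≥ 1 makes the set symmetric under y ↦ 1 - y.
Pair : ℤ → Pred (ℤ × ℤ) 0ℓ
Pair E (x , y) = 0ℤ ℤ.≤ x + y - 1ℤ × 0ℤ ℤ.≤ x - y × (x + y) * (x - y + 1ℤ) ≡ E

pairSign : ℤ × ℤ → ℤ
pairSign (x , y) = negOnePow (x + y)

Pair? : ∀ E → Decidable (Pair E)
Pair? E (x , y) = (0ℤ ℤ.≤? x + y - 1ℤ) ×-dec (0ℤ ℤ.≤? x - y) ×-dec ((x + y) * (x - y + 1ℤ) ℤ.≟ E)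

-- Zero is listed twice, which the deduplication in `SumOver-finite` absorbs.
interval : ℤ → List ℤ
interval b = map +_ (upTo (suc ∣ b ∣)) ++ map (λ m → - (+ m)) (upTo (suc ∣ b ∣))

∈-interval : ∀ b x → 0ℤ ℤ.≤ b - x → 0ℤ ℤ.≤ b + x → x ∈ interval b
∈-interval (+ n) (+ m) 0≤b-x _ =
  ∈-++⁺ˡ (∈-map⁺ +_ (∈-upTo⁺ (s≤s (ℤₚ.drop‿+≤+ (ℤₚ.0≤i-j⇒j≤i 0≤b-x)))))
∈-interval (+ n) -[1+ m ] _ 0≤b+x =
  ∈-++⁺ʳ (map +_ (upTo (suc n)))
    (∈-map⁺ (λ m → - (+ m)) (∈-upTo⁺ (s≤s (ℤₚ.drop‿+≤+ (ℤₚ.0≤i-j⇒j≤i 0≤b+x)))))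
∈-interval b@(-[1+ _ ]) x 0≤b-x 0≤b+x =
  contradiction (0≤-half {b} (by (0≤-+ 0≤b-x 0≤b+x) (sum b x))) λ ()
  where
  sum : ∀ b x → b + b ≡ (b - x) + (b + x)
  sum b x = solve (b ∷ x ∷ [])

Pair-finite : ∀ E → ∃ (SumOver (Pair E) pairSign)
Pair-finite E = SumOver-finite pairSign (≡-dec ℤ._≟_ ℤ._≟_) (Pair? E)
  (cartesianProduct (interval E) (interval E)) (λ {(x , y)} → bounded x y)
  where
  -- With A = x + y and B = x - y + 1 both at least 1 we have 2x = A + B - 1 ≤ A B = E.
  bounded : ∀ x y → Pair E (x , y) → (x , y) ∈ cartesianProduct (interval E) (interval E)
  bounded x y (a , b , h) = ∈-cartesianProduct⁺
    (∈-interval E x (by-modulo (0≤-+ (0≤-* a b) 0≤x) (-1ℤ · h) (solve (E ∷ x ∷ y ∷ [])))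
                (by-modulo (0≤-+ (0≤-* a b) (0≤-+ 0≤x (0≤-+ 0≤x 0≤x))) (-1ℤ · h) (solve (E ∷ x ∷ y ∷ []))))
    (∈-interval E y (by-modulo (0≤-+ (0≤-* a b) (0≤-+ 0≤x b)) (-1ℤ · h) (solve (E ∷ x ∷ y ∷ [])))
                (by-modulo (0≤-+ (0≤-* a b) (0≤-+ 0≤x (0≤-+ a 0≤1))) (-1ℤ · h) (solve (E ∷ x ∷ y ∷ []))))
    where
    0≤x : 0ℤ ℤ.≤ x
    0≤x = 0≤-half (by (0≤-+ (0≤-+ a b) 0≤1) (solve (x ∷ y ∷ [])))

-- The involution y ↦ 1 - y exchanges the factors x + y and x - y + 1 and changes x + y by the odd
-- number 1 - 2 y, so the sum equals its own negative.
Pair-cancel : ∀ {E q} → SumOver (Pair E) pairSign q → q ≡ 0ℤ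
Pair-cancel {E} {q} A = self-opposite q (SumOver-unique
    (SumOver-bij reflect reflect (λ {(x , y)} → pair x y) (λ {(x , y)} → pair x y)
      (λ {(x , y)} _ → cong (x ,_) (involutive y)) (λ {(x , y)} _ → cong (x ,_) (involutive y))
    (λ {(x , y)} _ → sign x y) A)
    (SumOver-scale -1ℤ A))
  where
  reflect : ℤ × ℤ → ℤ × ℤ
  reflect (x , y) = x , 1ℤ - y
  involutive : ∀ y → 1ℤ - (1ℤ - y) ≡ y
  involutive y = solve (y ∷ [])
  pair : ∀ x y → Pair E (x , y) → Pair E (x , 1ℤ - y)
  pair x y (a , b , h) =
    by b (solve (x ∷ y ∷ [])) , by a (solve (x ∷ y ∷ [])) , linear (1ℤ · h) (solve (E ∷ x ∷ y ∷ []))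
  sign : ∀ x y → -1ℤ * negOnePow (x + (1ℤ - y)) ≡ negOnePow (x + y)
  sign x y = sym (negOnePow-odd (x + y) (x + (1ℤ - y)) (y - 1ℤ) (solve (x ∷ y ∷ [])))
  self-opposite : ∀ q → q ≡ -1ℤ * q → q ≡ 0ℤ
  self-opposite (+ zero) _ = refl

-- Edges of the cone and the shift of quadruples

quad≡ : ∀ {k l k′ l′ i j i′ j′ : ℤ} → k ≡ i → l ≡ j → k′ ≡ i′ → l′ ≡ j′ →
        (k , l , k′ , l′) ≡ (i , j , i′ , j′)
quad≡ refl refl refl refl = refl

OnLeft OnLeft′ OnRight OnRight′ : Pred (ℤ × ℤ × ℤ × ℤ) 0ℓ
OnLeft   (k , l , _)      = k + l ≡ 0ℤ
OnLeft′  (_ , _ , k′ , l′) = k′ + l′ ≡ 0ℤ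
OnRight  (k , l , _)      = k - l ≡ 0ℤ
OnRight′ (_ , _ , k′ , l′) = k′ - l′ ≡ 0ℤ

onLeft? : Decidable OnLeft
onLeft? (k , l , _) = k + l ℤ.≟ 0ℤ

onLeft′? : Decidable OnLeft′
onLeft′? (_ , _ , k′ , l′) = k′ + l′ ℤ.≟ 0ℤ

onRight? : Decidable OnRight
onRight? (k , l , _) = k - l ℤ.≟ 0ℤ

onRight′? : Decidable OnRight′
onRight′? (_ , _ , k′ , l′) = k′ - l′ ℤ.≟ 0ℤ

swap : ℤ × ℤ × ℤ × ℤ → ℤ × ℤ × ℤ × ℤ
swap (k , l , k′ , l′) = k′ , l′ , k , l

Quad-swap : ∀ {E L} k l k′ l′ → Quad E L (k , l , k′ , l′) → Quad E L (k′ , l′ , k , l)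
Quad-swap {E} {L} k l k′ l′ (a , b , a′ , b′ , h , t) =
  a′ , b′ , a , b ,
  linear (1ℤ · h) (solve (E ∷ k ∷ l ∷ k′ ∷ l′ ∷ [])) , linear (1ℤ · t) (solve (L ∷ l ∷ l′ ∷ []))

quadSign-swap : ∀ k l k′ l′ → negOnePow (k′ + l′ + k + l) ≡ negOnePow (k + l + k′ + l′)
quadSign-swap k l k′ l′ =
  negOnePow-cong (k′ + l′ + k + l) (k + l + k′ + l′) (solve (k ∷ l ∷ k′ ∷ l′ ∷ []))

module Step {E L : ℤ} (0<E : 0ℤ ℤ.≤ E - 1ℤ) where

  -- The key after lowering l and l′ by one: (k + l - 1)(k - l + 2) exceeds (k + l)(k - l + 1) by 2
  -- l - 2.
  E⁺ L⁺ : ℤ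
  E⁺ = E + (L + L) - + 4
  L⁺ = L - + 2

  -- Otherwise both products vanish and E = 0. Hence the two left edges contribute disjoint sets.
  notBothLeft : ∀ k l k′ l′ → (k + l) * (k - l + 1ℤ) + (k′ + l′) * (k′ - l′ + 1ℤ) ≡ E →
                k + l ≡ 0ℤ → k′ + l′ ≢ 0ℤ
  notBothLeft k l k′ l′ h z z′ = positive⇒≢0 {E} 0<E
    (linear (-1ℤ · h ⊕ (k - l + 1ℤ) · z ⊕ (k′ - l′ + 1ℤ) · z′) (solve (E ∷ k ∷ l ∷ k′ ∷ l′ ∷ [])))

  -- Otherwise the products are 2 l and 2 l′, with sum 2 L - 4, which again forces E = 0.
  notBothRight : ∀ k l k′ l′ → (k + l) * (k - l + 1ℤ) + (k′ + l′) * (k′ - l′ + 1ℤ) ≡ E + (L + L) - + 4 →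
                 l + l′ ≡ L - + 2 → k - l ≡ 0ℤ → k′ - l′ ≢ 0ℤ
  notBothRight k l k′ l′ h t z z′ = positive⇒≢0 {E} 0<E
    (linear (-1ℤ · h ⊕ (k + l + 1ℤ) · z ⊕ (k′ + l′ + 1ℤ) · z′ ⊕ + 2 · t) (solve (E ∷ L ∷ k ∷ l ∷ k′ ∷ l′ ∷ [])))

  -- A pair in Q is completed by a first point with k + l = 0, a pair outside Q by one with k = l.
  Q : Pred (ℤ × ℤ) 0ℓ
  Q (_ , y) = 0ℤ ℤ.≤ y - L

  Q? : Decidable Q
  Q? (_ , y) = 0ℤ ℤ.≤? y - L

  -- A first point with k + l = 0 adds nothing to E or to the sign. It must be (y - L , L - y), and
  -- it lies in the cone exactly when y ≥ L.
  left : ∀ {v} → SumOver (Pair E ∩ Q) pairSign v → SumOver (Quad E L ∩ OnLeft) quadSign v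
  left = SumOver-bij (λ (x , y) → y - L , L - y , x , y) (λ (_ , _ , k′ , l′) → k′ , l′)
    (λ {(x , y)} → to x y) (λ {(k , l , k′ , l′)} → from k l k′ l′)
    (λ _ → refl) (λ {(k , l , k′ , l′)} → inverse k l k′ l′) (λ {(x , y)} _ → sign x y)
    where
    to : ∀ x y → (Pair E ∩ Q) (x , y) → (Quad E L ∩ OnLeft) (y - L , L - y , x , y)
    to x y ((a , b , h) , q) =
      ( by ℤₚ.≤-refl (solve (L ∷ y ∷ [])) , by (0≤-+ q q) (solve (L ∷ y ∷ []))
      , by (0≤-+ a 0≤1) (solve (x ∷ y ∷ [])) , b
      , linear (1ℤ · h) (solve (E ∷ L ∷ x ∷ y ∷ [])) , solve (L ∷ y ∷ []) )
      , solve (L ∷ y ∷ [])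
    from : ∀ k l k′ l′ → (Quad E L ∩ OnLeft) (k , l , k′ , l′) → (Pair E ∩ Q) (k′ , l′)
    from k l k′ l′ ((a , b , a′ , b′ , h , t) , z) =
      ( 0≤-pred a′ (notBothLeft k l k′ l′ h z)
      , b′ , linear (1ℤ · h ⊕ (- (k - l + 1ℤ)) · z) (solve (E ∷ k ∷ l ∷ k′ ∷ l′ ∷ [])) )
      , 0≤-half (by-modulo b (+ 2 · t ⊕ -1ℤ · z) (solve (L ∷ k ∷ l ∷ l′ ∷ [])))
    inverse : ∀ k l k′ l′ → (Quad E L ∩ OnLeft) (k , l , k′ , l′) →
              (l′ - L , L - l′ , k′ , l′) ≡ (k , l , k′ , l′)
    inverse k l k′ l′ ((a , b , a′ , b′ , h , t) , z) =
      quad≡ (linear (1ℤ · t ⊕ -1ℤ · z) (solve (L ∷ k ∷ l ∷ l′ ∷ [])))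
            (linear (-1ℤ · t) (solve (L ∷ l ∷ l′ ∷ []))) refl refl
    sign : ∀ x y → negOnePow (y - L + (L - y) + x + y) ≡ negOnePow (x + y)
    sign x y = negOnePow-cong (y - L + (L - y) + x + y) (x + y) (solve (L ∷ x ∷ y ∷ []))

  -- A first point with k = l has product 2 l and even k + l. Lowering y by one, which flips the
  -- sign, makes l = L - y - 1, and l ≥ 0 says exactly that y < L.
  right : ∀ {v} → SumOver (Pair E ∩ ∁ Q) pairSign v → SumOver (Quad E⁺ L⁺ ∩ OnRight) quadSign (-1ℤ * v)
  right A = SumOver-bij (λ (x , y) → L - y - 1ℤ , L - y - 1ℤ , x , y - 1ℤ) (λ (_ , _ , k′ , l′) → k′ , l′ + 1ℤ)
    (λ {(x , y)} → to x y) (λ {(k , l , k′ , l′)} → from k l k′ l′)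
    (λ {(x , y)} _ → cong (x ,_) (x-1+1≡x y)) (λ {(k , l , k′ , l′)} → inverse k l k′ l′)
    (λ {(x , y)} _ → sign x y) (SumOver-scale -1ℤ A)
    where
    to : ∀ x y → (Pair E ∩ ∁ Q) (x , y) → (Quad E⁺ L⁺ ∩ OnRight) (L - y - 1ℤ , L - y - 1ℤ , x , y - 1ℤ)
    to x y ((a , b , h) , ¬q) =
      ( by (0≤-+ (0≰⇒ ¬q) (0≰⇒ ¬q)) (solve (L ∷ y ∷ [])) , by ℤₚ.≤-refl (solve (L ∷ y ∷ []))
      , by a (solve (x ∷ y ∷ [])) , by (0≤-+ b 0≤1) (solve (x ∷ y ∷ []))
      , linear (1ℤ · h) (expand x y) , l+l′≡ y )
      , solve (L ∷ y ∷ [])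
      where
      expand : ∀ x y → (L - y - 1ℤ + (L - y - 1ℤ)) * (L - y - 1ℤ - (L - y - 1ℤ) + 1ℤ)
                         + (x + (y - 1ℤ)) * (x - (y - 1ℤ) + 1ℤ) - (E + (L + L) - + 4)
                       ≡ 1ℤ * ((x + y) * (x - y + 1ℤ) - E)
      expand x y = solve (E ∷ L ∷ x ∷ y ∷ [])
      l+l′≡ : ∀ y → L - y - 1ℤ + (y - 1ℤ) ≡ L - + 2
      l+l′≡ y = solve (L ∷ y ∷ [])
    from : ∀ k l k′ l′ → (Quad (E + (L + L) - + 4) (L - + 2) ∩ OnRight) (k , l , k′ , l′) →
           (Pair E ∩ ∁ Q) (k′ , l′ + 1ℤ)
    from k l k′ l′ ((a , b , a′ , b′ , h , t) , z) =
      ( by a′ (solve (k′ ∷ l′ ∷ []))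
      , by (0≤-pred b′ (notBothRight k l k′ l′ h t z)) (solve (k′ ∷ l′ ∷ []))
      , linear (1ℤ · h ⊕ (- (k + l + 1ℤ)) · z ⊕ (- + 2) · t) (solve (E ∷ L ∷ k ∷ l ∷ k′ ∷ l′ ∷ [])) )
      , λ q → 0≰-1 (0≤-+ q (0≤l)) (linear (1ℤ · t) (solve (L ∷ l ∷ l′ ∷ [])))
      where
      0≤l : 0ℤ ℤ.≤ l
      0≤l = 0≤-half (by-modulo a (-1ℤ · z) (solve (k ∷ l ∷ [])))
    inverse : ∀ k l k′ l′ → (Quad (E + (L + L) - + 4) (L - + 2) ∩ OnRight) (k , l , k′ , l′) →
      (L - (l′ + 1ℤ) - 1ℤ , L - (l′ + 1ℤ) - 1ℤ , k′ , l′ + 1ℤ - 1ℤ) ≡ (k , l , k′ , l′)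
    inverse k l k′ l′ ((a , b , a′ , b′ , h , t) , z) =
      quad≡ (linear (-1ℤ · t ⊕ -1ℤ · z) (solve (L ∷ k ∷ l ∷ l′ ∷ [])))
            (linear (-1ℤ · t) (solve (L ∷ l ∷ l′ ∷ []))) refl (solve (l′ ∷ []))
    sign : ∀ x y → negOnePow (L - y - 1ℤ + (L - y - 1ℤ) + x + (y - 1ℤ)) ≡ -1ℤ * negOnePow (x + y)
    sign x y = negOnePow-odd (L - y - 1ℤ + (L - y - 1ℤ) + x + (y - 1ℤ)) (x + y) (L - y - + 2)
      (solve (L ∷ x ∷ y ∷ []))

  -- Exchanging the two points carries `left` over to the second edge; by `notBothLeft`, removing
  -- the first edge takes nothing away from it.
  left′ : ∀ {v} → SumOver (Pair E ∩ Q) pairSign v → SumOver ((Quad E L ∩ ∁ OnLeft) ∩ OnLeft′) quadSign v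
  left′ A = SumOver-bij swap swap
    (λ { {k , l , k′ , l′} (q@(_ , _ , _ , _ , h , _) , z) →
      (Quad-swap k l k′ l′ q , notBothLeft k l k′ l′ h z) , z })
    (λ { {k , l , k′ , l′} ((q , _) , z) → Quad-swap k l k′ l′ q , z })
    (λ _ → refl) (λ _ → refl) (λ {(k , l , k′ , l′)} _ → quadSign-swap k l k′ l′) (left A)

  right′ : ∀ {v} → SumOver (Pair E ∩ ∁ Q) pairSign v →
           SumOver ((Quad E⁺ L⁺ ∩ ∁ OnRight) ∩ OnRight′) quadSign (-1ℤ * v)
  right′ A = SumOver-bij swap swap
    (λ { {k , l , k′ , l′} (q@(_ , _ , _ , _ , h , t) , z) →
      (Quad-swap k l k′ l′ q , notBothRight k l k′ l′ h t z) , z })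
    (λ { {k , l , k′ , l′} ((q , _) , z) → Quad-swap k l k′ l′ q , z })
    (λ _ → refl) (λ _ → refl) (λ {(k , l , k′ , l′)} _ → quadSign-swap k l k′ l′) (right A)

  -- Off the edges the shift stays inside both cones and is undone by raising l and l′; the exponent
  -- of the sign changes by 2.
  interior : ∀ {v} → SumOver ((Quad E L ∩ ∁ OnLeft) ∩ ∁ OnLeft′) quadSign v →
             SumOver ((Quad E⁺ L⁺ ∩ ∁ OnRight) ∩ ∁ OnRight′) quadSign v
  interior = SumOver-bij (λ (k , l , k′ , l′) → k , l - 1ℤ , k′ , l′ - 1ℤ)
    (λ (k , l , k′ , l′) → k , l + 1ℤ , k′ , l′ + 1ℤ)
    (λ {(k , l , k′ , l′)} → to k l k′ l′) (λ {(k , l , k′ , l′)} → from k l k′ l′)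
    (λ {(k , l , k′ , l′)} _ → quad≡ refl (x-1+1≡x l) refl (x-1+1≡x l′))
    (λ {(k , l , k′ , l′)} _ → quad≡ refl (x+1-1≡x l) refl (x+1-1≡x l′))
    (λ {(k , l , k′ , l′)} _ → sign k l k′ l′)
    where
    to : ∀ k l k′ l′ → ((Quad E L ∩ ∁ OnLeft) ∩ ∁ OnLeft′) (k , l , k′ , l′) →
         ((Quad E⁺ L⁺ ∩ ∁ OnRight) ∩ ∁ OnRight′) (k , l - 1ℤ , k′ , l′ - 1ℤ)
    to k l k′ l′ (((a , b , a′ , b′ , h , t) , ¬z) , ¬z′) =
      ( ( by (0≤-pred a ¬z) (solve (k ∷ l ∷ [])) , by (0≤-+ b 0≤1) (solve (k ∷ l ∷ []))
        , by (0≤-pred a′ ¬z′) (solve (k′ ∷ l′ ∷ [])) , by (0≤-+ b′ 0≤1) (solve (k′ ∷ l′ ∷ []))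
        , linear (1ℤ · h ⊕ + 2 · t) (expand k l k′ l′) , linear (1ℤ · t) (l+l′≡ l l′) )
      , λ z → 0≰-1 b (linear (1ℤ · z) (solve (k ∷ l ∷ []))) )
      , λ z′ → 0≰-1 b′ (linear (1ℤ · z′) (solve (k′ ∷ l′ ∷ [])))
      where
      expand : ∀ k l k′ l′ →
        (k + (l - 1ℤ)) * (k - (l - 1ℤ) + 1ℤ) + (k′ + (l′ - 1ℤ)) * (k′ - (l′ - 1ℤ) + 1ℤ) - (E + (L + L) - + 4)
        ≡ 1ℤ * ((k + l) * (k - l + 1ℤ) + (k′ + l′) * (k′ - l′ + 1ℤ) - E) + + 2 * (l + l′ - L)
      expand k l k′ l′ = solve (E ∷ L ∷ k ∷ l ∷ k′ ∷ l′ ∷ [])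
      l+l′≡ : ∀ l l′ → l - 1ℤ + (l′ - 1ℤ) - (L - + 2) ≡ 1ℤ * (l + l′ - L)
      l+l′≡ l l′ = solve (L ∷ l ∷ l′ ∷ [])
    from : ∀ k l k′ l′ → ((Quad (E + (L + L) - + 4) (L - + 2) ∩ ∁ OnRight) ∩ ∁ OnRight′) (k , l , k′ , l′) →
           ((Quad E L ∩ ∁ OnLeft) ∩ ∁ OnLeft′) (k , l + 1ℤ , k′ , l′ + 1ℤ)
    from k l k′ l′ (((a , b , a′ , b′ , h , t) , ¬z) , ¬z′) =
      ( ( by (0≤-+ a 0≤1) (solve (k ∷ l ∷ [])) , by (0≤-pred b ¬z) (solve (k ∷ l ∷ []))
        , by (0≤-+ a′ 0≤1) (solve (k′ ∷ l′ ∷ [])) , by (0≤-pred b′ ¬z′) (solve (k′ ∷ l′ ∷ []))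
        , linear (1ℤ · h ⊕ (- + 2) · t) (solve (E ∷ L ∷ k ∷ l ∷ k′ ∷ l′ ∷ []))
        , linear (1ℤ · t) (solve (L ∷ l ∷ l′ ∷ [])) )
      , λ z → 0≰-1 a (linear (1ℤ · z) (solve (k ∷ l ∷ []))) )
      , λ z′ → 0≰-1 a′ (linear (1ℤ · z′) (solve (k′ ∷ l′ ∷ [])))
    sign : ∀ k l k′ l′ → negOnePow (k + (l - 1ℤ) + k′ + (l′ - 1ℤ)) ≡ negOnePow (k + l + k′ + l′)
    sign k l k′ l′ = trans
      (negOnePow-cong (k + (l - 1ℤ) + k′ + (l′ - 1ℤ)) (k + l + k′ + l′ + (-1ℤ + -1ℤ))
        (solve (k ∷ l ∷ k′ ∷ l′ ∷ [])))
      (negOnePow-+2* (k + l + k′ + l′) -1ℤ)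

  -- Lowering l and l′ by 1 loses the points with k + l = 0 or k′ + l′ = 0 and misses the points with
  -- k = l or k′ = l′; both boundary sums are Pair sums, and they agree by Pair-cancel.
  Quad-shift : ∀ {c} → SumOver (Quad E L) quadSign c → SumOver (Quad E⁺ L⁺) quadSign c
  Quad-shift A =
    let u₁ , _  , A₁ , A′ , c≡  = SumOver-split onLeft? A
        u₂ , w  , A₂ , A₃ , a′≡ = SumOver-split onLeft′? A′
        p  , pairs              = Pair-finite E
        p₁ , p₂ , P₁ , P₂ , p≡  = SumOver-split Q? pairs
        c≡′ = trans c≡ (cong₂ _+_ (SumOver-unique A₁ (left P₁))
                (trans a′≡ (cong (_+ w) (SumOver-unique A₂ (left′ P₁)))))
    in subst (SumOver (Quad E⁺ L⁺) quadSign)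
         (sym (trans c≡′ (balance p₁ p₂ w (trans (sym p≡) (Pair-cancel pairs)))))
         (SumOver-merge onRight? (right P₂) (SumOver-merge onRight′? (right′ P₂) (interior A₃)))
    where
    balance : ∀ p₁ p₂ w → p₁ + p₂ ≡ 0ℤ → p₁ + (p₁ + w) ≡ -1ℤ * p₂ + (-1ℤ * p₂ + w)
    balance p₁ p₂ w h = linear (+ 2 · h) (solve (p₁ ∷ p₂ ∷ w ∷ []))

-- Comparison at a fixed key (E , L)

Rect : ℤ → ℤ → Pred (ℤ × ℤ) 0ℓ
Rect E L (s , u) = 0ℤ ℤ.≤ s × 0ℤ ℤ.≤ u - 1ℤ × s * u + s * u ≡ E × u - s ≡ 1ℤ - L

semiperimeter : ℤ × ℤ → ℤ
semiperimeter (s , u) = s + u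

-- There are no boundary terms here: E > 0 excludes s = 0 before the shift and u = 1 after it.
Rect-shift : ∀ {E L g} → 0ℤ ℤ.≤ E - 1ℤ → SumOver (Rect E L) semiperimeter g →
             SumOver (Rect (E + (L + L) - + 4) (L - + 2)) semiperimeter g
Rect-shift {E} {L} 0<E = SumOver-bij (λ (s , u) → s - 1ℤ , u + 1ℤ) (λ (s , u) → s + 1ℤ , u - 1ℤ)
  (λ {(s , u)} → to s u) (λ {(s , u)} → from s u)
  (λ {(s , u)} _ → cong₂ _,_ (x-1+1≡x s) (x+1-1≡x u)) (λ {(s , u)} _ → cong₂ _,_ (x+1-1≡x s) (x-1+1≡x u))
  (λ {(s , u)} _ → weight s u)
  where
  weight : ∀ s u → s - 1ℤ + (u + 1ℤ) ≡ s + u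
  weight s u = solve (s ∷ u ∷ [])
  to : ∀ s u → Rect E L (s , u) → Rect (E + (L + L) - + 4) (L - + 2) (s - 1ℤ , u + 1ℤ)
  to s u (a , b , h , t) =
      0≤-pred a (λ s≡0 → positive⇒≢0 {E} 0<E (linear (-1ℤ · h ⊕ (u + u) · s≡0) (solve (E ∷ s ∷ u ∷ []))))
    , by (0≤-+ b 0≤1) (solve (u ∷ []))
    , linear (1ℤ · h ⊕ (- + 2) · t) (solve (E ∷ L ∷ s ∷ u ∷ [])) , linear (1ℤ · t) (solve (L ∷ s ∷ u ∷ []))
  from : ∀ s u → Rect (E + (L + L) - + 4) (L - + 2) (s , u) → Rect E L (s + 1ℤ , u - 1ℤ)
  from s u (a , b , h , t) =
      0≤-+ a 0≤1
    -- If u = 1 then s = L - 2, so 2 s u = 2 L - 4 and E would be 0.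
    , 0≤-pred b (λ z → positive⇒≢0 {E} 0<E
        (linear (-1ℤ · h ⊕ (- + 2) · t ⊕ (s + s + + 2) · z) (solve (E ∷ L ∷ s ∷ u ∷ []))))
    , linear (1ℤ · h ⊕ + 2 · t) (solve (E ∷ L ∷ s ∷ u ∷ [])) , linear (1ℤ · t) (solve (L ∷ s ∷ u ∷ []))

-- Since (u - 1)(s + 1) = s u + (u - s) - 1 = s u - L, the product 2 s u drops by 2 L, while s + u
-- is kept.
Rect-reflect : ∀ {E L g} → SumOver (Rect E L) semiperimeter g →
               SumOver (Rect (E - (L + L)) (- L)) semiperimeter g
Rect-reflect {E} {L} = SumOver-bij (λ (s , u) → u - 1ℤ , s + 1ℤ) (λ (s , u) → u - 1ℤ , s + 1ℤ)
  (λ {(s , u)} → to s u) (λ {(s , u)} → from s u)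
  (λ {(s , u)} _ → cong₂ _,_ (x+1-1≡x s) (x-1+1≡x u)) (λ {(s , u)} _ → cong₂ _,_ (x+1-1≡x s) (x-1+1≡x u))
  (λ {(s , u)} _ → weight s u)
  where
  weight : ∀ s u → u - 1ℤ + (s + 1ℤ) ≡ s + u
  weight s u = solve (s ∷ u ∷ [])
  to : ∀ s u → Rect E L (s , u) → Rect (E - (L + L)) (- L) (u - 1ℤ , s + 1ℤ)
  to s u (a , b , h , t) = b , by a (solve (s ∷ []))
    , linear (1ℤ · h ⊕ + 2 · t) (solve (E ∷ L ∷ s ∷ u ∷ [])) , linear (-1ℤ · t) (solve (L ∷ s ∷ u ∷ []))
  from : ∀ s u → Rect (E - (L + L)) (- L) (s , u) → Rect E L (u - 1ℤ , s + 1ℤ)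
  from s u (a , b , h , t) = b , by a (solve (s ∷ []))
    , linear (1ℤ · h ⊕ + 2 · t) (solve (E ∷ L ∷ s ∷ u ∷ [])) , linear (-1ℤ · t) (solve (L ∷ s ∷ u ∷ []))

-- Negating l lowers k k - l l + k + l by 2 l and changes the exponent of the sign by an even
-- number.
Quad-reflect : ∀ {E L c} → SumOver (Quad E L) quadSign c → SumOver (Quad (E - (L + L)) (- L)) quadSign c
Quad-reflect {E} {L} = SumOver-bij (λ (k , l , k′ , l′) → k , - l , k′ , - l′)
  (λ (k , l , k′ , l′) → k , - l , k′ , - l′)
  (λ {(k , l , k′ , l′)} → to k l k′ l′) (λ {(k , l , k′ , l′)} → from k l k′ l′)
  (λ {(k , l , k′ , l′)} _ → quad≡ refl (ℤₚ.neg-involutive l) refl (ℤₚ.neg-involutive l′))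
  (λ {(k , l , k′ , l′)} _ → quad≡ refl (ℤₚ.neg-involutive l) refl (ℤₚ.neg-involutive l′))
  (λ {(k , l , k′ , l′)} _ → sign k l k′ l′)
  where
  to : ∀ k l k′ l′ → Quad E L (k , l , k′ , l′) → Quad (E - (L + L)) (- L) (k , - l , k′ , - l′)
  to k l k′ l′ (a , b , a′ , b′ , h , t) =
      b , by a (solve (k ∷ l ∷ [])) , b′ , by a′ (solve (k′ ∷ l′ ∷ []))
    , linear (1ℤ · h ⊕ (- + 2) · t) (solve (E ∷ L ∷ k ∷ l ∷ k′ ∷ l′ ∷ []))
    , linear (-1ℤ · t) (solve (L ∷ l ∷ l′ ∷ []))
  from : ∀ k l k′ l′ → Quad (E - (L + L)) (- L) (k , l , k′ , l′) → Quad E L (k , - l , k′ , - l′)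
  from k l k′ l′ (a , b , a′ , b′ , h , t) =
      b , by a (solve (k ∷ l ∷ [])) , b′ , by a′ (solve (k′ ∷ l′ ∷ []))
    , linear (1ℤ · h ⊕ (- + 2) · t) (solve (E ∷ L ∷ k ∷ l ∷ k′ ∷ l′ ∷ []))
    , linear (-1ℤ · t) (solve (L ∷ l ∷ l′ ∷ []))
  sign : ∀ k l k′ l′ → negOnePow (k + - l + k′ + - l′) ≡ negOnePow (k + l + k′ + l′)
  sign k l k′ l′ = trans
    (negOnePow-cong (k + - l + k′ + - l′) (k + l + k′ + l′ + (- (l + l′) + - (l + l′)))
      (solve (k ∷ l ∷ k′ ∷ l′ ∷ [])))
    (negOnePow-+2* (k + l + k′ + l′) (- (l + l′)))

-- For E = 0 both products vanish, so l = - k and l′ = - k′ with k + k′ = m. The m + 1 choices of k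
-- all have sign 1.
Quad-origin : ∀ m {L} → L ≡ - (+ m) → SumOver (Quad 0ℤ L) quadSign (+ suc m)
Quad-origin m {L} L≡-m = SumOver-bij (λ i → + i , - (+ i) , - L - + i , L + + i) (λ (k , _) → ∣ k ∣)
  (λ {i} i≤m → to (+ i) (+≤+ z≤n)
    (by-modulo (ℤₚ.i≤j⇒0≤j-i (+≤+ i≤m)) (-1ℤ · L≡-m) (bound (+ i) (+ m))))
  (λ {(k , l , k′ , l′)} q → ∣k∣≤m k l k′ l′ q)
  (λ _ → refl)
  (λ {(k , l , k′ , l′)} q → trans (cong (λ k → k , - k , - L - k , L + k) (ℤₚ.0≤i⇒+∣i∣≡i (0≤k k l k′ l′ q)))
    (inverse k l k′ l′ q))
  (λ {i} _ → sign (+ i))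
  (sumOver (upTo (suc m)) (Unique.upTo⁺ (suc m)) (λ i∈ → ℕₚ.≤-pred (∈-upTo⁻ i∈)) (λ i≤m → ∈-upTo⁺ (s≤s i≤m))
    (trans (ones (upTo (suc m))) (cong +_ (List.length-upTo (suc m)))))
  where
  ones : ∀ (xs : List ℕ) → sumℤ (map (λ _ → 1ℤ) xs) ≡ + length xs
  ones []       = refl
  ones (x ∷ xs) = cong (_+_ 1ℤ) (ones xs)
  bound : ∀ i M → - L - i ≡ M - i + -1ℤ * (L - - M)
  bound i M = solve (L ∷ i ∷ M ∷ [])
  to : ∀ i → 0ℤ ℤ.≤ i → 0ℤ ℤ.≤ - L - i → Quad 0ℤ L (i , - i , - L - i , L + i)
  to i 0≤i i≤-L =
      by ℤₚ.≤-refl (solve (i ∷ [])) , by (0≤-+ 0≤i 0≤i) (solve (i ∷ []))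
    , by ℤₚ.≤-refl (solve (L ∷ i ∷ [])) , by (0≤-+ i≤-L i≤-L) (solve (L ∷ i ∷ []))
    , solve (L ∷ i ∷ []) , solve (L ∷ i ∷ [])
  sign : ∀ i → negOnePow (i + - i + (- L - i) + (L + i)) ≡ 1ℤ
  sign i = negOnePow-cong (i + - i + (- L - i) + (L + i)) 0ℤ (solve (L ∷ i ∷ []))
  factors≡0 : ∀ k l k′ l′ → Quad 0ℤ L (k , l , k′ , l′) → k + l ≡ 0ℤ × k′ + l′ ≡ 0ℤ
  factors≡0 k l k′ l′ (a , b , a′ , b′ , h , _) =
      -- The factor k - l + 1 is at least 1, so k + l is bounded by a sum of nonnegative products
      -- that equals 0.
      0≤-antisym a (by-modulo (0≤-+ (0≤-* a b) (0≤-* a′ (0≤-+ b′ 0≤1))) (-1ℤ · h)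
        (solve (k ∷ l ∷ k′ ∷ l′ ∷ [])))
    , 0≤-antisym a′ (by-modulo (0≤-+ (0≤-* a′ b′) (0≤-* a (0≤-+ b 0≤1))) (-1ℤ · h)
        (solve (k ∷ l ∷ k′ ∷ l′ ∷ [])))
  0≤k : ∀ k l k′ l′ → Quad 0ℤ L (k , l , k′ , l′) → 0ℤ ℤ.≤ k
  0≤k k l _ _ (a , b , _) = 0≤-half (by (0≤-+ a b) (solve (k ∷ l ∷ [])))
  inverse : ∀ k l k′ l′ → Quad 0ℤ L (k , l , k′ , l′) → (k , - k , - L - k , L + k) ≡ (k , l , k′ , l′)
  inverse k l k′ l′ q@(_ , _ , _ , _ , _ , t) with z , z′ ← factors≡0 k l k′ l′ q =
    quad≡ refl (linear (-1ℤ · z) (solve (k ∷ l ∷ [])))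
      (linear (1ℤ · t ⊕ -1ℤ · z ⊕ -1ℤ · z′) (solve (L ∷ k ∷ l ∷ k′ ∷ l′ ∷ [])))
      (linear (1ℤ · z ⊕ -1ℤ · t) (solve (L ∷ k ∷ l ∷ l′ ∷ [])))
  ∣k∣≤m : ∀ k l k′ l′ → Quad 0ℤ L (k , l , k′ , l′) → ∣ k ∣ ≤ m
  ∣k∣≤m k l k′ l′ q@(_ , _ , a′ , b′ , _ , t) with z , z′ ← factors≡0 k l k′ l′ q =
    ℤₚ.drop‿+≤+ (subst (ℤ._≤ + m) (sym (ℤₚ.0≤i⇒+∣i∣≡i (0≤k k l k′ l′ q)))
      (ℤₚ.0≤i-j⇒j≤i (by-modulo (0≤k′ k′ l′ a′ b′) (1ℤ · L≡-m ⊕ 1ℤ · t ⊕ -1ℤ · z ⊕ -1ℤ · z′) (expand (+ m)))))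
    where
    0≤k′ : ∀ k′ l′ → 0ℤ ℤ.≤ k′ + l′ → 0ℤ ℤ.≤ k′ - l′ → 0ℤ ℤ.≤ k′
    0≤k′ k′ l′ a′ b′ = 0≤-half (by (0≤-+ a′ b′) (solve (k′ ∷ l′ ∷ [])))
    expand : ∀ M → M - k ≡ k′ + (1ℤ * (L - - M) + 1ℤ * (l + l′ - L) + -1ℤ * (k + l - 0ℤ) + -1ℤ * (k′ + l′ - 0ℤ))
    expand M = solve (L ∷ k ∷ l ∷ k′ ∷ l′ ∷ M ∷ [])

-- From s u = 0 and u ≥ 1 follows s = 0, which leaves the single point u = 1 - L.
Rect-origin : ∀ m {L} → L ≡ - (+ m) → SumOver (Rect 0ℤ L) semiperimeter (+ suc m)
Rect-origin m {L} L≡-m = sumOver ((0ℤ , 1ℤ - L) ∷ []) (All.[] ∷ [])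
  (λ { (here refl) → ℤₚ.≤-refl , by 0≤-L (solve (L ∷ [])) , solve (L ∷ []) , solve (L ∷ []) })
  (λ { {s , u} q → here (corner s u q) })
  (trans (value L) (cong (λ x → 1ℤ + x) -L≡m))
  where
  -L≡m : - L ≡ + m
  -L≡m = trans (cong -_ L≡-m) (ℤₚ.neg-involutive (+ m))
  0≤-L : 0ℤ ℤ.≤ - L
  0≤-L = by (+≤+ z≤n) -L≡m
  value : ∀ L → 0ℤ + (1ℤ - L) + 0ℤ ≡ 1ℤ + - L
  value L = solve (L ∷ [])
  corner : ∀ s u → Rect 0ℤ L (s , u) → (s , u) ≡ (0ℤ , 1ℤ - L)
  corner s u (a , b , h , t) = cong₂ _,_ s≡0 (linear (1ℤ · t ⊕ 1ℤ · s≡0) (solve (L ∷ s ∷ u ∷ [])))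
    where
    s≡0 : s ≡ 0ℤ
    s≡0 = 0≤-antisym a (by-modulo (0≤-+ (0≤-* a b) (0≤-+ (0≤-* a b) a)) (-1ℤ · h) (solve (s ∷ u ∷ [])))

Quad⇒0≤ : ∀ {E L} x → Quad E L x → 0ℤ ℤ.≤ E
Quad⇒0≤ {E} (k , l , k′ , l′) (a , b , a′ , b′ , h , _) = by-modulo
  (0≤-+ (0≤-* a (0≤-+ b 0≤1)) (0≤-* a′ (0≤-+ b′ 0≤1))) (-1ℤ · h) (solve (E ∷ k ∷ l ∷ k′ ∷ l′ ∷ []))

Rect⇒0≤ : ∀ {E L} x → Rect E L x → 0ℤ ℤ.≤ E
Rect⇒0≤ {E} (s , u) (a , b , h , _) = by-modulo
  (0≤-+ (0≤-* a (0≤-+ b 0≤1)) (0≤-* a (0≤-+ b 0≤1))) (-1ℤ · h) (solve (E ∷ s ∷ u ∷ []))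

-- Induction on `n`, an upper bound for `E`. For L ≤ 0 the shift lowers E by 4 - 2 L and keeps L ≤
-- 0.
Quad≡Rect-nonpositive : ∀ n E L → 0ℤ ℤ.≤ + n - E → 0ℤ ℤ.≤ - L → ∀ {c g} →
  SumOver (Quad E L) quadSign c → SumOver (Rect E L) semiperimeter g → c ≡ g
Quad≡Rect-nonpositive _ -[1+ e ] L _ _ A B =
  trans (SumOver-empty (λ x q → contradiction (Quad⇒0≤ {L = L} x q) λ ()) A)
        (sym (SumOver-empty (λ x q → contradiction (Rect⇒0≤ {L = L} x q) λ ()) B))
Quad≡Rect-nonpositive _ (+ zero) L _ 0≤-L A B =
  trans (SumOver-unique A (Quad-origin ∣ - L ∣ L≡)) (SumOver-unique (Rect-origin ∣ - L ∣ L≡) B)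
  where
  L≡ : L ≡ - + ∣ - L ∣
  L≡ = sym (trans (cong -_ (ℤₚ.0≤i⇒+∣i∣≡i 0≤-L)) (ℤₚ.neg-involutive L))
Quad≡Rect-nonpositive (suc n) E@(+ suc _) L E≤n 0≤-L A B =
  Quad≡Rect-nonpositive n (E + (L + L) - + 4) (L - + 2)
    -- The bound falls by one while E falls by at least 4, which leaves a slack of 3.
    (by (0≤-+ (0≤-+ E≤n (0≤-+ 0≤-L 0≤-L)) (+≤+ {0} {3} z≤n)) (bound E (+ n)))
    (by (0≤-+ 0≤-L (+≤+ {0} {2} z≤n)) (solve (L ∷ [])))
    (Step.Quad-shift {E} {L} (+≤+ z≤n) A) (Rect-shift {E} {L} (+≤+ z≤n) B)
  where
  bound : ∀ E n → n - (E + (L + L) - + 4) ≡ 1ℤ + n - E + (- L + - L) + + 3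
  bound E n = solve (E ∷ L ∷ n ∷ [])

0≤∣_∣- : ∀ x → 0ℤ ℤ.≤ + ∣ x ∣ - x
0≤∣ + n ∣-      = ℤₚ.i≤j⇒0≤j-i {+ n} ℤₚ.≤-refl
0≤∣ -[1+ n ] ∣- = +≤+ z≤n

Quad≡Rect : ∀ {E L c g} → SumOver (Quad E L) quadSign c → SumOver (Rect E L) semiperimeter g → c ≡ g
Quad≡Rect {E} {L} A B with 0ℤ ℤ.≤? - L
... | yes 0≤-L = Quad≡Rect-nonpositive ∣ E ∣ E L 0≤∣ E ∣- 0≤-L A B
... | no  0≰-L = Quad≡Rect-nonpositive ∣ E - (L + L) ∣ (E - (L + L)) (- L) 0≤∣ E - (L + L) ∣-
  (by (0≤-+ (0≰⇒ 0≰-L) 0≤1) (solve (L ∷ []))) (Quad-reflect {E} {L} A) (Rect-reflect {E} {L} B)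

-- From fixed keys to all solutions and lattice points

0≤k-m⇒0≤k+m : ∀ k m → 0ℤ ℤ.≤ k - m → 0ℤ ℤ.≤ m → 0ℤ ℤ.≤ k + m
0≤k-m⇒0≤k+m k m a b = by (0≤-+ a (0≤-+ b b)) (solve (k ∷ m ∷ []))

∣l∣≤k⇒ : ∀ k l → + ∣ l ∣ ℤ.≤ k → 0ℤ ℤ.≤ k + l × 0ℤ ℤ.≤ k - l
∣l∣≤k⇒ k l ∣l∣≤k with ℤₚ.i≤j⇒0≤j-i ∣l∣≤k
∣l∣≤k⇒ k (+ n)    _ | 0≤k-n = 0≤k-m⇒0≤k+m k (+ n) 0≤k-n (+≤+ z≤n) , 0≤k-n
∣l∣≤k⇒ k -[1+ n ] _ | 0≤k-n = 0≤k-n , 0≤k-m⇒0≤k+m k (+ suc n) 0≤k-n (+≤+ z≤n)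

∣l∣≤k⇐ : ∀ k l → 0ℤ ℤ.≤ k + l → 0ℤ ℤ.≤ k - l → + ∣ l ∣ ℤ.≤ k
∣l∣≤k⇐ k (+ n)    _ b = ℤₚ.0≤i-j⇒j≤i b
∣l∣≤k⇐ k -[1+ n ] a _ = ℤₚ.0≤i-j⇒j≤i a

Lattice : ℤ → ℤ → ℤ → Pred (ℤ × ℤ) 0ℓ
Lattice P R N (s , u) = 0ℤ ℤ.≤ s × 0ℤ ℤ.≤ u - 1ℤ × P * (s * u) + R * (u - s) ≡ N

OnLevel : ℤ → ℤ → ℤ → ℤ → ℤ → Set
OnLevel P R N E L = P * E + + 2 * (R * (1ℤ - L)) ≡ + 2 * N

solution⇒OnLevel : ∀ P R N k l k′ l′ →
  + 2 * N ≡ (P * (k * k - l * l) + P * (k + l) - + 2 * l * R)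
          + (P * (k′ * k′ - l′ * l′) + P * (k′ + l′) - + 2 * l′ * R) + + 2 * R →
  P * ((k + l) * (k - l + 1ℤ) + (k′ + l′) * (k′ - l′ + 1ℤ)) + + 2 * (R * (1ℤ - (l + l′))) ≡ + 2 * N
solution⇒OnLevel P R N k l k′ l′ h = linear (-1ℤ · h) (solve (P ∷ R ∷ N ∷ k ∷ l ∷ k′ ∷ l′ ∷ []))

OnLevel⇒solution : ∀ P R N k l k′ l′ →
  P * ((k + l) * (k - l + 1ℤ) + (k′ + l′) * (k′ - l′ + 1ℤ)) + + 2 * (R * (1ℤ - (l + l′))) ≡ + 2 * N →
  + 2 * N ≡ (P * (k * k - l * l) + P * (k + l) - + 2 * l * R)
          + (P * (k′ * k′ - l′ * l′) + P * (k′ + l′) - + 2 * l′ * R) + + 2 * R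
OnLevel⇒solution P R N k l k′ l′ h = linear (-1ℤ · h) (solve (P ∷ R ∷ N ∷ k ∷ l ∷ k′ ∷ l′ ∷ []))

lattice⇒OnLevel : ∀ P R N s u → P * (s * u) + R * (u - s) ≡ N →
  P * (s * u + s * u) + + 2 * (R * (1ℤ - (1ℤ - (u - s)))) ≡ + 2 * N
lattice⇒OnLevel P R N s u h = linear (+ 2 · h) (solve (P ∷ R ∷ N ∷ s ∷ u ∷ []))

OnLevel⇒lattice : ∀ P R N s u →
  P * (s * u + s * u) + + 2 * (R * (1ℤ - (1ℤ - (u - s)))) ≡ + 2 * N → P * (s * u) + R * (u - s) ≡ N
OnLevel⇒lattice P R N s u h =
  ℤₚ.*-cancelˡ-≡ (+ 2) _ _ (linear (1ℤ · h) (solve (P ∷ R ∷ N ∷ s ∷ u ∷ [])))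

module _ (p r n : ℕ) where

  quadKey : ℤ × ℤ × ℤ × ℤ → ℤ × ℤ
  quadKey (k , l , k′ , l′) = (k + l) * (k - l + 1ℤ) + (k′ + l′) * (k′ - l′ + 1ℤ) , l + l′

  latticeKey : ℤ × ℤ → ℤ × ℤ
  latticeKey (s , u) = s * u + s * u , 1ℤ - (u - s)

  -- Both defining equations depend only on the key. If the key satisfies `OnLevel`, the fibres are
  -- `Quad E L` and `Rect E L`; if not, both are empty.
  solutions≡lattice : ∀ {c g} → SumOver (IsSolution p r n) quadSign c →
                      SumOver (Lattice (+ p) (+ r) (+ n)) semiperimeter g → c ≡ g
  solutions≡lattice = SumOver-fibrewise (≡-dec ℤ._≟_ ℤ._≟_) quadKey latticeKey fibre
    where
    1-[1-x]≡x : ∀ x → x ≡ 1ℤ - (1ℤ - x)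
    1-[1-x]≡x x = solve (x ∷ [])
    L≡1-[u-s] : ∀ L s u → u - s ≡ 1ℤ - L → L ≡ 1ℤ - (u - s)
    L≡1-[u-s] L s u t = linear (1ℤ · t) (solve (L ∷ s ∷ u ∷ []))
    fibre : ∀ κ {a b} → SumOver (λ x → IsSolution p r n x × quadKey x ≡ κ) quadSign a →
            SumOver (λ y → Lattice (+ p) (+ r) (+ n) y × latticeKey y ≡ κ) semiperimeter b → a ≡ b
    fibre (E , L) A B with + p * E + + 2 * (+ r * (1ℤ - L)) ℤ.≟ + 2 * + n
    ... | yes level = Quad≡Rect {E} {L}
      (SumOver-resp
        (λ { {k , l , k′ , l′} ((a , b , _) , refl) →
          let a₁ , a₂ = ∣l∣≤k⇒ k l a
              b₁ , b₂ = ∣l∣≤k⇒ k′ l′ b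
          in a₁ , a₂ , b₁ , b₂ , refl , refl })
        (λ { {k , l , k′ , l′} (a₁ , a₂ , b₁ , b₂ , refl , refl) →
          ( ∣l∣≤k⇐ k l a₁ a₂ , ∣l∣≤k⇐ k′ l′ b₁ b₂
          , OnLevel⇒solution (+ p) (+ r) (+ n) k l k′ l′ level ) , refl })
        A)
      (SumOver-resp
        (λ { {s , u} ((a , b , _) , refl) → a , b , refl , 1-[1-x]≡x (u - s) })
        (λ { {s , u} (a , b , refl , t) → let L≡ = L≡1-[u-s] L s u t in
          ( a , b , OnLevel⇒lattice (+ p) (+ r) (+ n) s u
                      (subst (OnLevel (+ p) (+ r) (+ n) (s * u + s * u)) L≡ level) )
          , cong (s * u + s * u ,_) (sym L≡) })
        B)
    ... | no ¬level = trans
      (SumOver-empty (λ { (k , l , k′ , l′) ((_ , _ , h) , refl) →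
        ¬level (solution⇒OnLevel (+ p) (+ r) (+ n) k l k′ l′ h) }) A)
      (sym (SumOver-empty (λ { (s , u) ((_ , _ , h) , refl) →
        ¬level (lattice⇒OnLevel (+ p) (+ r) (+ n) s u h) }) B))

-- Divisor pairs as lattice points

module _ (p r n : ℕ) (0<r : 0 < r) (r<p : r < p) (coprime : gcd r p ≡ 1) (0<n : 1 ≤ n) where

  private
    instance
      p≢0 : ℕ.NonZero p
      p≢0 = ℕ.>-nonZero (ℕₚ.<-trans 0<r r<p)

    positive : ∀ {m} → 1 ≤ m → 0ℤ ℤ.≤ + m - 1ℤ
    positive 1≤m = ℤₚ.i≤j⇒0≤j-i (+≤+ 1≤m)

  -- Junk value 0 when p does not divide x.
  quotient : ℤ → ℤ
  quotient x with + p ∣? x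
  ... | yes (divides q _) = q
  ... | no _              = 0ℤ

  quotient-spec : ∀ {x} s → x ≡ s * + p → quotient x ≡ s
  quotient-spec {x} s x≡sp with + p ∣? x
  ... | yes (divides q x≡qp) = ℤₚ.*-cancelʳ-≡ q s (+ p) (trans (sym x≡qp) x≡sp)
  ... | no p∤x               = contradiction (divides s x≡sp) p∤x

  divisorPair⇒lattice : ∀ P R N s u d δ → .{{ℤ.NonZero P}} →
    0ℤ ℤ.≤ N - 1ℤ → 0ℤ ℤ.≤ R → 0ℤ ℤ.≤ P - R → 0ℤ ℤ.≤ d - 1ℤ →
    δ * d ≡ P * N - R * R → d - R ≡ s * P → δ + R ≡ u * P → Lattice P R N (s , u)
  divisorPair⇒lattice P R N s u d δ 0<N 0≤R R≤P 0<d h d≡ δ≡ = 0≤s , 0<u , eq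
    where
    eq : P * (s * u) + R * (u - s) ≡ N
    eq = ℤₚ.*-cancelˡ-≡ P _ _ (linear (1ℤ · h ⊕ (- d) · δ≡ ⊕ (R - u * P) · d≡)
           (solve (P ∷ R ∷ N ∷ s ∷ u ∷ d ∷ δ ∷ [])))
    0≤s : 0ℤ ℤ.≤ s
    -- If s ≤ -1 then d = R + s P ≤ R - P ≤ 0, against d ≥ 1.
    0≤s = 0≤-stable λ s<0 → 0≰-1 (0≤-+ (0≤-+ R≤P (0≤-* (0≤-+ 0≤R R≤P) s<0)) 0<d)
      (linear (1ℤ · d≡) (solve (P ∷ R ∷ s ∷ d ∷ [])))
    0<u : 0ℤ ℤ.≤ u - 1ℤ
    -- If u ≤ 0 then, as s ≥ 0, P s u + R (u - s) ≤ 0, against N ≥ 1.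
    0<u = 0≤-stable λ u≤0 → 0≰-1
      (0≤-+ (0≤-+ (0≤-* u≤0 (0≤-+ (0≤-* (0≤-+ 0≤R R≤P) 0≤s) 0≤R)) (0≤-* 0≤R 0≤s)) 0<N)
      (linear (-1ℤ · eq) (solve (P ∷ R ∷ N ∷ s ∷ u ∷ [])))

  lattice⇒product : ∀ P R N s u → P * (s * u) + R * (u - s) ≡ N → (u * P - R) * (R + s * P) ≡ P * N - R * R
  lattice⇒product P R N s u h = linear (P · h) (solve (P ∷ R ∷ N ∷ s ∷ u ∷ []))

  -- Modulo p, r (δ + r) ≡ δ d + r r = p n ≡ 0, and r is coprime to p.
  cofactor-divisible : ∀ d δ → IsDivisorPair p r n (d , δ) → + p ∣ δ + + r
  cofactor-divisible d δ (h , _ , p∣d-r) with ∣ᵤ⇒∣ p∣d-r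
  ... | divides s d≡ = ∣ᵤ⇒∣ (ℤ-Coprimality.coprime-divisor (+ p) (+ r) (δ + + r)
    (Coprimality.sym (Coprimality.gcd≡1⇒coprime coprime))
    -- Substituting r = d - s p in δ r gives r (δ + r) = p n - δ s p.
    (∣⇒∣ᵤ (divides (+ n - δ * s) (expand (+ p) (+ r) (+ n)
      (trans h (cong₂ _-_ (ℤₚ.pos-* p n) (ℤₚ.pos-* r r))) d≡))))
    where
    expand : ∀ P R N → δ * d ≡ P * N - R * R → d - R ≡ s * P → R * (δ + R) ≡ (N - δ * s) * P
    expand P R N h d≡ = linear (1ℤ · h ⊕ (- δ) · d≡) (solve (P ∷ R ∷ N ∷ s ∷ d ∷ δ ∷ []))

  quotients : ∀ d δ → IsDivisorPair p r n (d , δ) → ∃₂ λ s u → d - + r ≡ s * + p × δ + + r ≡ u * + p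
  quotients d δ q@(_ , _ , p∣d-r) with ∣ᵤ⇒∣ p∣d-r | cofactor-divisible d δ q
  ... | divides s d≡ | divides u δ≡ = s , u , d≡ , δ≡

  -- The substitution d = r + s p, δ = u p - r gives d + δ = p (s + u). The weight `w` is fixed only
  -- pointwise, so that the summand of `divisorSum` fits.
  divisors⇒lattice : ∀ {w v} → (∀ d δ → w (d , δ) ≡ d + δ) → SumOver (IsDivisorPair p r n) w v →
                     SumOver (Lattice (+ p) (+ r) (+ n)) (λ x → + p * semiperimeter x) v
  divisors⇒lattice w≗ = SumOver-bij (λ (d , δ) → quotient (d - + r) , quotient (δ + + r))
    (λ (s , u) → + r + s * + p , u * + p - + r)
    (λ {(d , δ)} → to d δ) (λ {(s , u)} → from s u)
    (λ {(d , δ)} → left-inverse d δ)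
    (λ {(s , u)} _ → cong₂ _,_ (quotient-spec s (cancel⁻ (+ p) (+ r) s))
                            (quotient-spec u (cancel⁺ (+ p) (+ r) u)))
    (λ {(d , δ)} q → trans (weight d δ q) (sym (w≗ d δ)))
    where
    cancel⁻ : ∀ P R s → R + s * P - R ≡ s * P
    cancel⁻ P R s = solve (P ∷ R ∷ s ∷ [])
    cancel⁺ : ∀ P R u → u * P - R + R ≡ u * P
    cancel⁺ P R u = solve (P ∷ R ∷ u ∷ [])
    to : ∀ d δ → IsDivisorPair p r n (d , δ) →
         Lattice (+ p) (+ r) (+ n) (quotient (d - + r) , quotient (δ + + r))
    to d δ q@(h , 0<d , _) =
      let s , u , d≡ , δ≡ = quotients d δ q in
      subst₂ (λ s u → Lattice (+ p) (+ r) (+ n) (s , u)) (sym (quotient-spec s d≡)) (sym (quotient-spec u δ≡))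
        (divisorPair⇒lattice (+ p) (+ r) (+ n) s u d δ (positive 0<n) (+≤+ z≤n)
          (ℤₚ.i≤j⇒0≤j-i (+≤+ (ℕₚ.<⇒≤ r<p))) (ℤₚ.i≤j⇒0≤j-i (ℤₚ.i<j⇒suc[i]≤j 0<d))
          (trans h (cong₂ _-_ (ℤₚ.pos-* p n) (ℤₚ.pos-* r r))) d≡ δ≡)
    from : ∀ s u → Lattice (+ p) (+ r) (+ n) (s , u) → IsDivisorPair p r n (+ r + s * + p , u * + p - + r)
    from s u (0≤s , _ , h) =
        trans (lattice⇒product (+ p) (+ r) (+ n) s u h) (sym (cong₂ _-_ (ℤₚ.pos-* p n) (ℤₚ.pos-* r r)))
      , ℤₚ.suc[i]≤j⇒i<j (ℤₚ.0≤i-j⇒j≤i (by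
          (0≤-+ (positive 0<r) (0≤-* 0≤s (+≤+ {0} {p} z≤n))) (expand (+ p) (+ r))))
      , ∣⇒∣ᵤ (divides s (cancel⁻ (+ p) (+ r) s))
      where
      expand : ∀ P R → R + s * P - 1ℤ ≡ R - 1ℤ + s * P
      expand P R = solve (P ∷ R ∷ s ∷ [])
    left-inverse : ∀ d δ → IsDivisorPair p r n (d , δ) →
      (+ r + quotient (d - + r) * + p , quotient (δ + + r) * + p - + r) ≡ (d , δ)
    left-inverse d δ q =
      let s , u , d≡ , δ≡ = quotients d δ q in
      cong₂ _,_ (trans (cong (λ x → + r + x * + p) (quotient-spec s d≡)) (first (+ p) (+ r) s d≡))
                (trans (cong (λ x → x * + p - + r) (quotient-spec u δ≡)) (second (+ p) (+ r) u δ≡))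
      where
      first : ∀ P R s → d - R ≡ s * P → R + s * P ≡ d
      first P R s d≡ = linear (-1ℤ · d≡) (solve (P ∷ R ∷ s ∷ d ∷ []))
      second : ∀ P R u → δ + R ≡ u * P → u * P - R ≡ δ
      second P R u δ≡ = linear (-1ℤ · δ≡) (solve (P ∷ R ∷ u ∷ δ ∷ []))
    weight : ∀ d δ → IsDivisorPair p r n (d , δ) → + p * (quotient (d - + r) + quotient (δ + + r)) ≡ d + δ
    weight d δ q =
      let s , u , d≡ , δ≡ = quotients d δ q in
      trans (cong₂ (λ x y → + p * (x + y)) (quotient-spec s d≡) (quotient-spec u δ≡))
            (scale (+ p) (+ r) s u d≡ δ≡)
      where
      scale : ∀ P R s u → d - R ≡ s * P → δ + R ≡ u * P → P * (s + u) ≡ d + δ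
      scale P R s u d≡ δ≡ = linear (-1ℤ · d≡ ⊕ -1ℤ · δ≡) (solve (P ∷ R ∷ s ∷ u ∷ d ∷ δ ∷ []))

theorem1p2 : (p r : ℕ) → 0 < r → r < p → gcd r p ≡ 1 →
    (n : ℕ) → 1 ≤ n →
    (D : List (ℤ × ℤ)) → Unique D → (∀ x → (x ∈ D) ⇔ IsDivisorPair p r n x) →
    (S : List (ℤ × ℤ × ℤ × ℤ)) → Unique S → (∀ x → (x ∈ S) ⇔ IsSolution p r n x) →
    divisorSum D ≡ + p * signSum S
theorem1p2 p r 0<r r<p coprime n 0<n D D! D⇔ S S! S⇔ = begin
  divisorSum D     ≡⟨ SumOver-unique divisors (SumOver-scale (+ p) lattice) ⟩
  + p * _          ≡⟨ cong (+ p *_) (solutions≡lattice p r n solutions lattice) ⟨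
  + p * signSum S  ∎
  where
  open ≡-Reasoning
  divisors : SumOver (Lattice (+ p) (+ r) (+ n)) (λ x → + p * semiperimeter x) (divisorSum D)
  divisors = divisors⇒lattice p r n 0<r r<p coprime 0<n (λ _ _ → refl) (SumOver-⇔ D D! D⇔)
  -- The finite list of lattice points is inherited from `D`; only the factor p is dropped from the
  -- weight.
  lattice = proj₂ (SumOver-reweight semiperimeter divisors)
  solutions : SumOver (IsSolution p r n) quadSign (signSum S)
  solutions = SumOver-bij id id id id (λ _ → refl) (λ _ → refl) (λ {(k , l , k′ , l′)} _ → refl)
    (SumOver-⇔ S S! S⇔)
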